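{- If $n$ is even, then there exists a line spread $\mathcal F$ of $\mathrm{PG}(2n-1,q)$ such that every line of $\mathcal F$ is scattered with respect to the Desarguesian spread $\mathcal S$, i.e. meets every element of $\mathcal S$ in at most one point.
   Context: Let $q$ be a prime power, $n>1$ an integer, $F=\mathbb F_q\subset M=\mathbb F_{q^n}\subset L=\mathbb F_{q^{2n}}$. Regard $L$ as a $2n$-dimensional $F$-vector space; $\mathrm{PG}(2n-1,q)$ has as points the subspaces $Fz$, $z\in L^*$, and lines the 2-dimensional $F$-subspaces. $\mathcal S$ is the Desarguesian spread of $(n-1)$-subspaces of $\mathrm{PG}(2n-1,q)$ consisting of the projective subspaces determined by the one-dimensional $M$-subspaces $Mz$, $z\in L^*$. A line spread is a set of lines partitioning the point set. A set of points is scattered with respect to a spread if it meets each spread element in at most one point. -}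

module Defs where

open import Level using (Level; _⊔_; suc)
open import Algebra.Bundles using (CommutativeRing)
import Algebra.Definitions
import Algebra.Properties.Monoid.Sum
open import Data.Fin.Base using (Fin)
open import Data.Nat.Base as ℕ using (ℕ)
open import Data.Nat.Primality using (Prime)
open import Data.Product using (Σ; ∃; ∃-syntax; _×_; _,_; proj₁; proj₂)
open import Data.Vec.Functional using (Vector)
open import Function.Bundles using (Inverse)
open import Relation.Binary.Bundles using (Setoid)
import Relation.Binary.Construct.On as On
open import Relation.Binary.PropositionalEquality using (_≡_)
import Relation.Binary.PropositionalEquality as ≡
open import Relation.Nullary using (¬_)
open import Relation.Unary using (Pred; _∈_; _⊆_; _≐_)

IsPrimePower : ℕ → Set
IsPrimePower q = ∃[ p ] ∃[ k ] Prime p × 1 ℕ.≤ k × q ≡ p ℕ.^ k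

HasCardinality : ∀ {c ℓ} → Setoid c ℓ → ℕ → Set (c ⊔ ℓ)
HasCardinality S N = Inverse S (≡.setoid (Fin N))

-- Inverses are only required for elements that are not ≈ 0#.  No decidability
-- is built in: for finite fields it follows from HasCardinality.
record Field (c ℓ : Level) : Set (suc (c ⊔ ℓ)) where
  field
    commutativeRing : CommutativeRing c ℓ
  open CommutativeRing commutativeRing public
  open Algebra.Definitions _≈_ public using (Invertible)
  field
    0≉1     : ¬ (0# ≈ 1#)
    inverse : ∀ x → ¬ (x ≈ 0#) → Invertible 1# _*_ x

module _ {c ℓ : Level} (L : Field c ℓ) where
  open Field L
  open Algebra.Properties.Monoid.Sum +-monoid using (sum)

  Subset : Set (suc (c ⊔ ℓ))
  Subset = Pred Carrier (c ⊔ ℓ)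

  record IsSubfield (K : Subset) : Set (c ⊔ ℓ) where
    field
      ∈-resp-≈ : ∀ {x y} → x ≈ y → x ∈ K → y ∈ K
      0∈       : 0# ∈ K
      1∈       : 1# ∈ K
      +-closed : ∀ {x y} → x ∈ K → y ∈ K → (x + y) ∈ K
      neg-closed : ∀ {x} → x ∈ K → (- x) ∈ K
      *-closed : ∀ {x y} → x ∈ K → y ∈ K → (x * y) ∈ K
      inv-closed : ∀ {x y} → x ∈ K → (x * y) ≈ 1# → y ∈ K

  -- The elements of K, compared in L (membership proofs are ignored).
  subsetSetoid : Subset → Setoid (c ⊔ ℓ) ℓ
  subsetSetoid K = On.setoid {B = Σ Carrier K} setoid proj₁

  NonZeroElement : Set (c ⊔ ℓ)
  NonZeroElement = ∃[ z ] ¬ (z ≈ 0#)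

  multiples : Subset → Carrier → Subset
  multiples K z x = ∃[ a ] a ∈ K × x ≈ a * z

  -- The spread of the M-subspaces Mz, z ≠ 0, as subsets of L.
  DesarguesianSpread : Subset → Pred Subset (c ⊔ ℓ)
  DesarguesianSpread M X = Σ NonZeroElement λ z → X ≐ multiples M (proj₁ z)

  -- L as a vector space over its subfield F, and the projective space PG(L).
  module PG (F : Subset) where

    linearCombination : ∀ {k} → Vector Carrier k → Vector Carrier k → Carrier
    linearCombination a b = sum (λ i → a i * b i)

    Span : ∀ {k} → Vector Carrier k → Subset
    Span b x = ∃[ a ] (∀ i → a i ∈ F) × x ≈ linearCombination a b

    LinearlyIndependent : ∀ {k} → Vector Carrier k → Set (c ⊔ ℓ)
    LinearlyIndependent b =
      ∀ a → (∀ i → a i ∈ F) → linearCombination a b ≈ 0# → ∀ i → a i ≈ 0#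

    -- U is an F-subspace of dimension k; being a span, it is automatically
    -- closed under the vector space operations.
    IsSubspaceOfDim : ℕ → Subset → Set (c ⊔ ℓ)
    IsSubspaceOfDim k U =
      Σ (Vector Carrier k) λ b → LinearlyIndependent b × U ≐ Span b

    -- A point is given by a nonzero z and stands for the subspace Fz, so
    -- points are to be compared with _≈ₚ_.
    Point : Set (c ⊔ ℓ)
    Point = NonZeroElement

    ⟦_⟧ : Point → Subset
    ⟦ z , _ ⟧ = multiples F z

    _≈ₚ_ : Point → Point → Set (c ⊔ ℓ)
    P ≈ₚ Q = ⟦ P ⟧ ≐ ⟦ Q ⟧

    pointsOf : Subset → Pred Point (c ⊔ ℓ)
    pointsOf U P = ⟦ P ⟧ ⊆ U

    IsLine : Subset → Set (c ⊔ ℓ)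
    IsLine = IsSubspaceOfDim 2

    record IsLineSpread (𝓕 : Pred Subset (c ⊔ ℓ)) : Set (suc (c ⊔ ℓ)) where
      field
        lines  : ∀ U → U ∈ 𝓕 → IsLine U
        covers : ∀ P → ∃[ U ] U ∈ 𝓕 × P ∈ pointsOf U
        unique : ∀ P U V → U ∈ 𝓕 → V ∈ 𝓕 →
                 P ∈ pointsOf U → P ∈ pointsOf V → U ≐ V

    IsScattered : Pred Point (c ⊔ ℓ) → Pred Subset (c ⊔ ℓ) → Set (suc (c ⊔ ℓ))
    IsScattered T 𝒮 = ∀ X → X ∈ 𝒮 → ∀ P Q →
      P ∈ T → P ∈ pointsOf X → Q ∈ T → Q ∈ pointsOf X → P ≈ₚ Q

{-# OPTIONS --safe #-}

-- Let K = 𝔽_{q²}, which lies in M because n is even.  The K-subspaces Kx form a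
-- line spread of L, but each of them lies in an element of the Desarguesian
-- spread; it is therefore twisted by an F-linear bijection ψ = id + φ, where φ is
-- additive, φ(kx) = k^q φ(x) for k ∈ K, and φ(x) ∉ Mx for x ≠ 0.  If ψ(kw) = m ψ(w)
-- with k ∈ K, m ∈ M and w ≠ 0, then (k − m) w = (m − k^q) φ(w), so m = k^q = k
-- and k ∈ F: the lines ψ(Kx) are scattered.
-- Writing L = M ⊕ Mω, one may take φ(a + bω) = η b^q + a^q ω for any η ∈ M that is
-- not a (q+1)-th power in M; such η exist because q + 1 divides |M| − 1.
module Submission where

open import Defs
open import Level using (Level; Lift; lift; _⊔_)
open import Algebra.Bundles using (CommutativeMonoid)
import Algebra.Properties.AbelianGroup
import Algebra.Properties.CommutativeMonoid.Sum
import Algebra.Properties.CommutativeSemiring.Binomial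
import Algebra.Properties.CommutativeSemiring.Exp
import Algebra.Properties.Monoid.Mult
import Algebra.Properties.Ring
import Algebra.Properties.Semiring.Mult
import Algebra.Solver.Ring.NaturalCoefficients.Default
open import Data.Empty using (⊥)
open import Data.Fin.Base as Fin using (Fin; zero; suc; toℕ; fromℕ; inject₁; inject≤; punchIn; punchOut)
open import Data.Fin.Permutation as Perm using (Permutation′; permutation; _⟨$⟩ʳ_)
import Data.Fin.Properties as Fin
open import Data.Nat.Base as ℕ using (ℕ; zero; suc; s≤s; z≤n; _!; _∸_)
open import Data.Nat.Combinatorics using (_C_; nCk≡n!/k![n-k]!; k![n∸k]!∣n!; nCn≡1)
open import Data.Nat.Divisibility using (_∣_; divides; ∣⇒≤; m∣m*n)
import Data.Nat.DivMod as ℕ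
open import Data.Nat.Primality using (Prime; euclidsLemma; prime⇒nonTrivial; prime⇒nonZero)
import Data.Nat.Properties as ℕ
open import Data.Nat.Tactic.RingSolver using (solve-∀)
open import Data.Product using (Σ; ∃-syntax; _×_; _,_; proj₁; proj₂)
open import Data.Sum.Base using (inj₁; inj₂)
open import Data.Unit.Base using (⊤; tt)
open import Data.Vec.Base using (Vec; []; _∷_; replicate)
open import Function.Base using (_∘_)
open import Function.Bundles using (Inverse)
open import Relation.Binary.Bundles using (Setoid)
open import Relation.Binary.Definitions using (Decidable)
open import Relation.Binary.PropositionalEquality as ≡ using (_≡_)
open import Relation.Nullary using (¬_; yes; no; contradiction)
open import Relation.Nullary.Decidable using (¬?; decidable-stable; map′)
open import Relation.Unary using (Pred; _∈_; _⊆_; _≐_)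

-- The twist must fail to be K-linear: for a K-linear φ the line ψ(Kx) = Kψ(x) would still lie in
-- Mψ(x). The q-th power is an automorphism of K with fixed field F, so ψ stays F-linear while
-- comparing k with k^q forces k into F. The condition φ(x) ∉ Mx does double duty. It makes x and
-- φ(x) independent over M, so that coefficients can be compared, and it excludes φ(x) = -x, so that
-- ψ is injective and hence bijective on the finite field L. An additive map acting on each
-- coordinate separately cannot satisfy it, since it sends 1 into M; this is why φ exchanges the two
-- coordinates. Counting roots of X^(N+1) - X yields a nonzero x in M with x^N ≠ 1, where N = (|M| -
-- 1)/(q + 1). This x serves twice: as η, and through a power θ that generates K over F. K itself is
-- described by the equation z^(q²) = z, and a single treatment of quadratic extensions covers both
-- K over F and L over M.

prime∤! : ∀ {p m} → Prime p → m ℕ.< p → ¬ (p ∣ m !)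
prime∤! {p} {zero} pr m<p p∣1 =
  ℕ.<⇒≱ (ℕ.nonTrivial⇒n>1 p {{prime⇒nonTrivial pr}}) (∣⇒≤ p∣1)
prime∤! {p} {suc m} pr m<p p∣m! with euclidsLemma (suc m) (m !) pr p∣m!
... | inj₁ p∣1+m = ℕ.<⇒≱ m<p (∣⇒≤ p∣1+m)
... | inj₂ p∣m!  = prime∤! pr (ℕ.<-trans (ℕ.n<1+n m) m<p) p∣m!

n!≡nCk*k![n∸k]! : ∀ {n k} → k ℕ.≤ n → n ! ≡ (n C k) ℕ.* (k ! ℕ.* (n ∸ k) !)
n!≡nCk*k![n∸k]! {n} {k} k≤n = begin
  n !                                      ≡⟨ ℕ.m/n*n≡m (k![n∸k]!∣n! k≤n) ⟨
  n ! ℕ./ (k ! ℕ.* (n ∸ k) !) ℕ.* (k ! ℕ.* (n ∸ k) !)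
    ≡⟨ ≡.cong (ℕ._* (k ! ℕ.* (n ∸ k) !)) (nCk≡n!/k![n-k]! k≤n) ⟨
  (n C k) ℕ.* (k ! ℕ.* (n ∸ k) !)          ∎
  where
  open ≡.≡-Reasoning
  instance _ = ℕ._!*_!≢0 k (n ∸ k)

-- A prime p divides p! = C(p,k) · k! · (p - k)!, and it divides neither factorial because both k
-- and p - k are below p.
prime∣C : ∀ {p k} → Prime (suc p) → 0 ℕ.< k → k ℕ.< suc p → suc p ∣ suc p C k
prime∣C {p} {k} pr 0<k k<p
  with euclidsLemma (suc p C k) (k ! ℕ.* (suc p ∸ k) !) pr
         (≡.subst (suc p ∣_) (n!≡nCk*k![n∸k]! (ℕ.<⇒≤ k<p)) (m∣m*n (p !)))
... | inj₁ p∣C = p∣C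
... | inj₂ p∣k![p∸k]! with euclidsLemma (k !) ((suc p ∸ k) !) pr p∣k![p∸k]!
...   | inj₁ p∣k!    = contradiction p∣k! (prime∤! pr k<p)
...   | inj₂ p∣[p∸k]! =
  contradiction p∣[p∸k]! (prime∤! pr (ℕ.∸-monoʳ-< 0<k (ℕ.<⇒≤ k<p)))

-- Finite sets and sums over them

injective⇒surjective : ∀ {n} (f : Fin n → Fin n) → (∀ {i j} → f i ≡ f j → i ≡ j) →
                       ∀ j → ∃[ i ] f i ≡ j
injective⇒surjective {suc n} f f-inj j with Fin.any? (λ i → f i Fin.≟ j)
... | yes (i , fi≡j) = i , fi≡j
-- A missed value `j` could be punched out, giving an injection of `Fin (suc n)` into `Fin n`.
... | no  ∄i = contradiction (Fin.injective⇒≤ avoid-injective) ℕ.1+n≰n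
  where
  j≢f : ∀ i → ¬ (j ≡ f i)
  j≢f i j≡fi = ∄i (i , ≡.sym j≡fi)

  avoid-injective : ∀ {i i′} → punchOut (j≢f i) ≡ punchOut (j≢f i′) → i ≡ i′
  avoid-injective {i} {i′} = f-inj ∘ Fin.punchOut-injective (j≢f i) (j≢f i′)

module _ {c ℓ} (S : Setoid c ℓ) {N : ℕ} (card : HasCardinality S N) where
  open Setoid S
  open Inverse card

  to-injective : ∀ {x y} → to x ≡ to y → x ≈ y
  to-injective {x} {y} eq = trans (sym (strictlyInverseʳ x)) (trans (from-cong eq) (strictlyInverseʳ y))

  from-injective : ∀ {i j} → from i ≈ from j → i ≡ j
  from-injective {i} {j} eq =
    ≡.trans (≡.sym (strictlyInverseˡ i)) (≡.trans (to-cong eq) (strictlyInverseˡ j))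

  finite⇒≈-dec : Decidable _≈_
  finite⇒≈-dec x y = map′ to-injective to-cong (to x Fin.≟ to y)

  finite∧injective⇒surjective : (f : Carrier → Carrier) → (∀ {x y} → f x ≈ f y → x ≈ y) →
                                ∀ y → ∃[ x ] f x ≈ y
  finite∧injective⇒surjective f f-inj y =
    let i , eq = injective⇒surjective (to ∘ f ∘ from) (from-injective ∘ f-inj ∘ to-injective) (to y)
    in  from i , to-injective eq

module _ {c ℓ} (G : CommutativeMonoid c ℓ) where
  open CommutativeMonoid G
  open Algebra.Properties.CommutativeMonoid.Sum G
    using (sum; sum-permute; sum-cong-≋; ∑-distrib-+; sum-replicate)
  open Algebra.Properties.Monoid.Mult monoid using () renaming (_×_ to _·_)
  open import Relation.Binary.Reasoning.Setoid setoid

  -- Stated for commutative monoids because it serves twice: additively it shows that |A| · 1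
  -- vanishes, multiplicatively it gives Fermat's identity.
  sum-translate : ∀ {n} (e : Fin n → Carrier) (π : Permutation′ n) t →
                  (∀ i → e (π ⟨$⟩ʳ i) ≈ t ∙ e i) → sum e ≈ (n · t) ∙ sum e
  sum-translate {n} e π t e∘π≈t∙e = begin
    sum e                        ≈⟨ sum-permute e π ⟩
    sum (λ i → e (π ⟨$⟩ʳ i))     ≈⟨ sum-cong-≋ e∘π≈t∙e ⟩
    sum (λ i → t ∙ e i)          ≈⟨ ∑-distrib-+ (λ _ → t) e ⟩
    sum {n} (λ _ → t) ∙ sum e    ≈⟨ ∙-congʳ (sum-replicate n) ⟩
    (n · t) ∙ sum e              ∎

-- Field arithmetic

module FieldProperties {c ℓ} (L : Field c ℓ) where
  open Field L public hiding (zero)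
  open Algebra.Properties.CommutativeSemiring.Exp commutativeSemiring public
  open Algebra.Properties.Semiring.Mult semiring public
    using (×-congʳ; ×-assoc-*; ×-assocˡ; ×-homo-1; ×1-homo-*) renaming (_×_ to _·_)
  open Algebra.Properties.Ring ring public
    using ( -1*x≈-x; -‿distribʳ-*; -‿injective; x[y-z]≈xy-xz; [y-z]x≈yx-zx; ⁻¹-anti-homo-//
          ; +-cancelʳ; +-identityˡ-unique; +-inverseˡ-unique; //-rightDividesˡ)
    renaming (x∙y⁻¹≈ε⇒x≈y to x-y≈0⇒x≈y)
  open Algebra.Solver.Ring.NaturalCoefficients.Default commutativeSemiring public
    using (solve; _:=_; _:+_; _:*_)
  open import Relation.Binary.Reasoning.Setoid setoid

  *-cancelˡ-≉0 : ∀ {x y z} → ¬ (x ≈ 0#) → x * y ≈ x * z → y ≈ z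
  *-cancelˡ-≉0 {x} {y} {z} x≉0 xy≈xz with x⁻¹ , x⁻¹x≈1 , _ ← inverse x x≉0 = begin
    y              ≈⟨ *-identityˡ y ⟨
    1# * y         ≈⟨ *-congʳ x⁻¹x≈1 ⟨
    x⁻¹ * x * y    ≈⟨ *-assoc x⁻¹ x y ⟩
    x⁻¹ * (x * y)  ≈⟨ *-congˡ xy≈xz ⟩
    x⁻¹ * (x * z)  ≈⟨ *-assoc x⁻¹ x z ⟨
    x⁻¹ * x * z    ≈⟨ *-congʳ x⁻¹x≈1 ⟩
    1# * z         ≈⟨ *-identityˡ z ⟩
    z              ∎

  xy≈0∧x≉0⇒y≈0 : ∀ {x y} → ¬ (x ≈ 0#) → x * y ≈ 0# → y ≈ 0#
  xy≈0∧x≉0⇒y≈0 {x} x≉0 xy≈0 = *-cancelˡ-≉0 x≉0 (trans xy≈0 (sym (zeroʳ x)))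

  *-≉0 : ∀ {x y} → ¬ (x ≈ 0#) → ¬ (y ≈ 0#) → ¬ (x * y ≈ 0#)
  *-≉0 x≉0 y≉0 xy≈0 = y≉0 (xy≈0∧x≉0⇒y≈0 x≉0 xy≈0)

  x*y≉0⇒x≉0 : ∀ {x y} → ¬ (x * y ≈ 0#) → ¬ (x ≈ 0#)
  x*y≉0⇒x≉0 {x} {y} xy≉0 x≈0 = xy≉0 (trans (*-congʳ x≈0) (zeroˡ y))

  x⁻¹x≈1⇒yz≈yx⁻¹[xz] : ∀ {x x⁻¹} → x⁻¹ * x ≈ 1# → ∀ y z → y * z ≈ y * x⁻¹ * (x * z)
  x⁻¹x≈1⇒yz≈yx⁻¹[xz] {x} {x⁻¹} x⁻¹x≈1 y z = begin
    y * z                ≈⟨ *-congˡ (*-identityˡ z) ⟨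
    y * (1# * z)         ≈⟨ *-congˡ (*-congʳ x⁻¹x≈1) ⟨
    y * (x⁻¹ * x * z)
      ≈⟨ solve 4 (λ y i x z → y :* (i :* x :* z) := y :* i :* (x :* z)) refl y x⁻¹ x z ⟩
    y * x⁻¹ * (x * z)    ∎

  ^-≉0 : ∀ {x} n → ¬ (x ≈ 0#) → ¬ (x ^ n ≈ 0#)
  ^-≉0 zero    x≉0 1≈0 = 0≉1 (sym 1≈0)
  ^-≉0 (suc n) x≉0     = *-≉0 x≉0 (^-≉0 n x≉0)

  0^n≈0 : ∀ {n} → 1 ℕ.≤ n → 0# ^ n ≈ 0#
  0^n≈0 {suc n} _ = zeroˡ (0# ^ n)

  1^n≈1 : ∀ n → 1# ^ n ≈ 1#
  1^n≈1 zero    = refl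
  1^n≈1 (suc n) = trans (*-identityˡ _) (1^n≈1 n)

  x+y≈z+w⇒x-z≈w-y : ∀ {x y z w} → x + y ≈ z + w → x - z ≈ w - y
  x+y≈z+w⇒x-z≈w-y {x} {y} {z} {w} eq = begin
    x - z                  ≈⟨ +-identityʳ _ ⟨
    x - z + 0#             ≈⟨ +-congˡ (-‿inverseʳ y) ⟨
    x - z + (y - y)
      ≈⟨ solve 4 (λ x y z′ y′ → x :+ z′ :+ (y :+ y′) := x :+ y :+ (z′ :+ y′)) refl x y (- z) (- y) ⟩
    x + y + (- z - y)      ≈⟨ +-congʳ eq ⟩
    z + w + (- z - y)
      ≈⟨ solve 4 (λ z w z′ y′ → z :+ w :+ (z′ :+ y′) := w :+ y′ :+ (z :+ z′)) refl z w (- z) (- y) ⟩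
    w - y + (z - z)        ≈⟨ +-congˡ (-‿inverseʳ z) ⟩
    w - y + 0#             ≈⟨ +-identityʳ _ ⟩
    w - y                  ∎

  x-y≈z-w⇒x+w≈z+y : ∀ {x y z w} → x - y ≈ z - w → x + w ≈ z + y
  x-y≈z-w⇒x+w≈z+y {x} {y} {z} {w} eq = begin
    x + w                  ≈⟨ x≈x-y+y x y ⟩
    x - y + y + w          ≈⟨ +-congʳ (+-congʳ eq) ⟩
    z - w + y + w
      ≈⟨ solve 4 (λ z w′ y w → z :+ w′ :+ y :+ w := z :+ w′ :+ w :+ y) refl z (- w) y w ⟩
    z - w + w + y          ≈⟨ x≈x-y+y z w ⟨
    z + y                  ∎
    where
    x≈x-y+y : ∀ {t} x y → x + t ≈ x - y + y + t
    x≈x-y+y x y = +-congʳ (sym (//-rightDividesˡ y x))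

  -- Roots of monic polynomials

  -- c₀ ∷ … ∷ cₙ₋₁ ∷ [] encodes the monic polynomial c₀ + … + cₙ₋₁ Xⁿ⁻¹ + Xⁿ.
  eval : ∀ {n} → Vec Carrier n → Carrier → Carrier
  eval []       x = 1#
  eval (a ∷ as) x = a + x * eval as x

  -- Synthetic division of f - f(r) by X - r: each coefficient of the quotient is the value at `r`
  -- of a tail of f.
  quotient : ∀ {n} → Vec Carrier (suc n) → Carrier → Vec Carrier n
  quotient (a ∷ [])       r = []
  quotient (a ∷ as@(_ ∷ _)) r = eval as r ∷ quotient as r

  -- f(x) − f(r) = (x − r) g(x), with both sides moved so that no subtraction occurs.
  eval-quotient : ∀ {n} (as : Vec Carrier (suc n)) r x →
                  eval as x + r * eval (quotient as r) x ≈ x * eval (quotient as r) x + eval as r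
  eval-quotient (a ∷ []) r x =
    solve 4 (λ a r x o → a :+ x :* o :+ r :* o := x :* o :+ (a :+ r :* o)) refl a r x 1#
  eval-quotient (a ∷ as@(_ ∷ _)) r x = begin
    a + x * p + r * (p₀ + x * g)
      ≈⟨ solve 6 (λ a r x p p₀ g → a :+ x :* p :+ r :* (p₀ :+ x :* g) := a :+ r :* p₀ :+ x :* (p :+ r :* g))
           refl a r x p p₀ g ⟩
    a + r * p₀ + x * (p + r * g)    ≈⟨ +-congˡ (*-congˡ (eval-quotient as r x)) ⟩
    a + r * p₀ + x * (x * g + p₀)
      ≈⟨ solve 5 (λ a r x p₀ g → a :+ r :* p₀ :+ x :* (x :* g :+ p₀) := x :* (p₀ :+ x :* g) :+ (a :+ r :* p₀))
           refl a r x p₀ g ⟩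
    x * (p₀ + x * g) + (a + r * p₀) ∎
    where
    p  = eval as x
    p₀ = eval as r
    g  = eval (quotient as r) x

  -- Induction on the degree: the first root is divided out, and the others remain roots of the
  -- quotient because their differences from it are nonzero and cancel.
  monic-few-roots : ∀ {n} (as : Vec Carrier n) (e : Fin (suc n) → Carrier) →
                    (∀ {i j} → e i ≈ e j → i ≡ j) → ¬ (∀ i → eval as (e i) ≈ 0#)
  monic-few-roots []          e e-inj roots = 0≉1 (sym (roots zero))
  monic-few-roots as@(_ ∷ _) e e-inj roots =
    monic-few-roots (quotient as r) (e ∘ suc) (Fin.suc-injective ∘ e-inj) quotient-root
    where
    r = e zero
    quotient-root : ∀ i → eval (quotient as r) (e (suc i)) ≈ 0#
    quotient-root i = xy≈0∧x≉0⇒y≈0 x-r≉0 (begin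
      (x - r) * g      ≈⟨ [y-z]x≈yx-zx g x r ⟩
      x * g - r * g    ≈⟨ x+y≈z+w⇒x-z≈w-y (trans (sym (eval-quotient as r x)) (+-comm _ _)) ⟩
      eval as x - eval as r ≈⟨ +-cong (roots (suc i)) (-‿cong (roots zero)) ⟩
      0# - 0# ≈⟨ -‿inverseʳ 0# ⟩
      0#               ∎)
      where
      x = e (suc i)
      g = eval (quotient as r) x
      x-r≉0 : ¬ (x - r ≈ 0#)
      x-r≉0 x-r≈0 with () ← e-inj (x-y≈0⇒x≈y x r x-r≈0)

  few-^-fixed : ∀ {m} → 2 ℕ.≤ m → (e : Fin (suc m) → Carrier) →
                (∀ {i j} → e i ≈ e j → i ≡ j) → ¬ (∀ i → e i ^ m ≈ e i)
  few-^-fixed {suc (suc k)} (s≤s (s≤s _)) e e-inj fixed =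
    -- The polynomial X^m - X; since m ≥ 2, the coefficient -1 does not collide with the leading
    -- one.
    monic-few-roots (0# ∷ - 1# ∷ replicate k 0#) e e-inj λ i → begin
      0# + e i * (- 1# + e i * eval (replicate k 0#) (e i)) ≈⟨ +-identityˡ _ ⟩
      e i * (- 1# + e i * eval (replicate k 0#) (e i)) ≈⟨ *-congˡ (+-congˡ (*-congˡ (eval-X^ k))) ⟩
      e i * (- 1# + e i ^ suc k)      ≈⟨ distribˡ (e i) (- 1#) (e i ^ suc k) ⟩
      e i * - 1# + e i ^ suc (suc k)  ≈⟨ +-cong (trans (*-comm _ _) (-1*x≈-x (e i))) (fixed i) ⟩
      - e i + e i                     ≈⟨ -‿inverseˡ (e i) ⟩
      0#                              ∎
    where
    eval-X^ : ∀ k {x} → eval (replicate k 0#) x ≈ x ^ k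
    eval-X^ zero    = refl
    eval-X^ (suc k) = trans (+-identityˡ _) (*-congˡ (eval-X^ k))

  product : ∀ {n} → (Fin n → Carrier) → Carrier
  product = Algebra.Properties.CommutativeMonoid.Sum.sum *-commutativeMonoid

  product-≉0 : ∀ {n} (e : Fin n → Carrier) → (∀ i → ¬ (e i ≈ 0#)) → ¬ (product e ≈ 0#)
  product-≉0 {zero}  e e≉0 1≈0 = 0≉1 (sym 1≈0)
  product-≉0 {suc n} e e≉0     = *-≉0 (e≉0 zero) (product-≉0 (e ∘ suc) (e≉0 ∘ suc))

  -- Removing the index of 0 leaves a permutation, and the product of the other
  -- elements is a unit.
  multiplication-permutes⇒x^n≈x :
    ∀ {n x} (e : Fin n → Carrier) → (∀ {i j} → e i ≈ e j → i ≡ j) →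
    (π : Permutation′ n) → (∀ i → e (π ⟨$⟩ʳ i) ≈ x * e i) →
    ∀ i₀ → e i₀ ≈ 0# → x ^ n ≈ x
  multiplication-permutes⇒x^n≈x {suc n} {x} e e-inj π π-spec i₀ eᵢ₀≈0 = begin
    x * x ^ n   ≈⟨ *-congˡ (*-cancelˡ-≉0 (product-≉0 e′ e′≉0) (begin
                     product e′ * x ^ n   ≈⟨ *-comm _ _ ⟩
                     x ^ n * product e′
                       ≈⟨ sum-translate *-commutativeMonoid e′ (Perm.remove i₀ π) x π′-spec ⟨
                     product e′           ≈⟨ *-identityʳ _ ⟨
                     product e′ * 1#      ∎)) ⟩
    x * 1#      ≈⟨ *-identityʳ x ⟩
    x           ∎
    where
    e′ : Fin n → Carrier
    e′ = e ∘ punchIn i₀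

    e′≉0 : ∀ i → ¬ (e′ i ≈ 0#)
    e′≉0 i e′ᵢ≈0 = Fin.punchInᵢ≢i i₀ i (e-inj (trans e′ᵢ≈0 (sym eᵢ₀≈0)))

    π-i₀ : π ⟨$⟩ʳ i₀ ≡ i₀
    π-i₀ = e-inj (begin
      e (π ⟨$⟩ʳ i₀)  ≈⟨ π-spec i₀ ⟩
      x * e i₀       ≈⟨ *-congˡ eᵢ₀≈0 ⟩
      x * 0#         ≈⟨ zeroʳ x ⟩
      0#             ≈⟨ eᵢ₀≈0 ⟨
      e i₀           ∎)

    π′-spec : ∀ i → e′ (Perm.remove i₀ π ⟨$⟩ʳ i) ≈ x * e′ i
    π′-spec i = begin
      e (punchIn i₀ (Perm.remove i₀ π ⟨$⟩ʳ i))
        ≡⟨ ≡.cong (λ j → e (punchIn j (Perm.remove i₀ π ⟨$⟩ʳ i))) π-i₀ ⟨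
      e (punchIn (π ⟨$⟩ʳ i₀) (Perm.remove i₀ π ⟨$⟩ʳ i))
        ≡⟨ ≡.cong e (Perm.punchIn-permute π i₀ i) ⟨
      e (π ⟨$⟩ʳ punchIn i₀ i)   ≈⟨ π-spec (punchIn i₀ i) ⟩
      x * e′ i                  ∎

  -- Characteristic p and Frobenius powers

  AdditivePower : ℕ → Set (c ⊔ ℓ)
  AdditivePower Q = ∀ x y → (x + y) ^ Q ≈ x ^ Q + y ^ Q

  p·1≈0⇒p·x≈0 : ∀ {p} → p · 1# ≈ 0# → ∀ x → p · x ≈ 0#
  p·1≈0⇒p·x≈0 {p} p·1≈0 x = begin
    p · x          ≈⟨ ×-congʳ p (*-identityˡ x) ⟨
    p · (1# * x)   ≈⟨ ×-assoc-* p 1# x ⟨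
    p · 1# * x     ≈⟨ *-congʳ p·1≈0 ⟩
    0# * x         ≈⟨ zeroˡ x ⟩
    0#             ∎

  -- All binomial coefficients strictly between the two ends are multiples of p by `prime∣C`, so
  -- their terms vanish.
  frobenius : ∀ {p} → Prime p → p · 1# ≈ 0# → AdditivePower p
  frobenius {suc p} pr p·1≈0 x y = begin
    (x + y) ^ suc p                             ≈⟨ Binomial.theorem (suc p) x y ⟩
    term zero + sum (λ k → term (suc k))
      ≈⟨ +-cong first (sum-init-last (λ k → term (suc k))) ⟩
    y ^ suc p + (sum (λ k → term (suc (inject₁ k))) + term (fromℕ (suc p)))
      ≈⟨ +-congˡ (+-cong (trans (sum-cong-≋ middle) (sum-replicate-zero p)) last) ⟩
    y ^ suc p + (0# + x ^ suc p)                ≈⟨ +-congˡ (+-identityˡ _) ⟩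
    y ^ suc p + x ^ suc p                       ≈⟨ +-comm _ _ ⟩
    x ^ suc p + y ^ suc p                       ∎
    where
    module Binomial = Algebra.Properties.CommutativeSemiring.Binomial commutativeSemiring
    open Algebra.Properties.CommutativeMonoid.Sum +-commutativeMonoid

    term : Fin (suc (suc p)) → Carrier
    term = Binomial.binomialTerm x y (suc p)

    first : term zero ≈ y ^ suc p
    first = trans (×-homo-1 _) (*-identityˡ _)

    last : term (fromℕ (suc p)) ≈ x ^ suc p
    last = begin
      term (fromℕ (suc p))
        ≡⟨ ≡.cong (λ k → (suc p C k) · (x ^ k * y ^ (suc p ∸ k))) (Fin.toℕ-fromℕ (suc p)) ⟩
      (suc p C suc p) · (x ^ suc p * y ^ (p ∸ p))
        ≡⟨ ≡.cong₂ (λ a b → a · (x ^ suc p * y ^ b)) (nCn≡1 (suc p)) (ℕ.n∸n≡0 p) ⟩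
      1 · (x ^ suc p * 1#)  ≈⟨ ×-homo-1 _ ⟩
      x ^ suc p * 1#        ≈⟨ *-identityʳ _ ⟩
      x ^ suc p             ∎

    middle : ∀ k → term (suc (inject₁ k)) ≈ 0#
    middle k
      with divides d C≡dp ← prime∣C pr (s≤s z≤n)
             (s≤s (≡.subst (ℕ._< p) (≡.sym (Fin.toℕ-inject₁ k)) (Fin.toℕ<n k))) = begin
      (suc p C suc (toℕ (inject₁ k))) · b  ≡⟨ ≡.cong (_· b) (≡.trans C≡dp (ℕ.*-comm d (suc p))) ⟩
      (suc p ℕ.* d) · b                  ≈⟨ ×-assocˡ b (suc p) d ⟨
      suc p · (d · b)                    ≈⟨ p·1≈0⇒p·x≈0 {suc p} p·1≈0 (d · b) ⟩
      0#                                 ∎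
      where
      b = Binomial.binomial x y (suc p) (suc (inject₁ k))

  AdditivePower-^ : ∀ {p} → AdditivePower p → ∀ k → AdditivePower (p ℕ.^ k)
  AdditivePower-^ {p} additive zero x y =
    trans (*-identityʳ _) (+-cong (sym (*-identityʳ _)) (sym (*-identityʳ _)))
  AdditivePower-^ {p} additive (suc k) x y = begin
    (x + y) ^ (p ℕ.* p ℕ.^ k)              ≈⟨ ^-assocʳ (x + y) p (p ℕ.^ k) ⟨
    ((x + y) ^ p) ^ (p ℕ.^ k)              ≈⟨ ^-congˡ (p ℕ.^ k) (additive x y) ⟩
    (x ^ p + y ^ p) ^ (p ℕ.^ k)            ≈⟨ AdditivePower-^ additive k (x ^ p) (y ^ p) ⟩
    (x ^ p) ^ (p ℕ.^ k) + (y ^ p) ^ (p ℕ.^ k)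
      ≈⟨ +-cong (^-assocʳ x p (p ℕ.^ k)) (^-assocʳ y p (p ℕ.^ k)) ⟩
    x ^ (p ℕ.* p ℕ.^ k) + y ^ (p ℕ.* p ℕ.^ k) ∎

  -- Derived from additivity rather than from the sign (-1)^Q, so odd and even `Q` are treated
  -- alike.
  AdditivePower-neg : ∀ {Q} → 1 ℕ.≤ Q → AdditivePower Q → ∀ x → (- x) ^ Q ≈ - (x ^ Q)
  AdditivePower-neg {Q} 1≤Q additive x = +-inverseˡ-unique _ _ (begin
    (- x) ^ Q + x ^ Q   ≈⟨ additive (- x) x ⟨
    (- x + x) ^ Q       ≈⟨ ^-congˡ Q (-‿inverseˡ x) ⟩
    0# ^ Q              ≈⟨ 0^n≈0 1≤Q ⟩
    0#                  ∎)

  AdditivePower-sub : ∀ {Q} → 1 ℕ.≤ Q → AdditivePower Q → ∀ x y → (x - y) ^ Q ≈ x ^ Q - y ^ Q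
  AdditivePower-sub 1≤Q additive x y = trans (additive x (- y)) (+-congˡ (AdditivePower-neg 1≤Q additive y))

  -- The element p^k · 1 is the k-th power of p · 1, and a field has no nonzero nilpotents. This
  -- extracts the characteristic from the order of `F`.
  [p^k]·1≈0⇒p·1≈0 : Decidable _≈_ → ∀ p k → (p ℕ.^ k) · 1# ≈ 0# → p · 1# ≈ 0#
  [p^k]·1≈0⇒p·1≈0 _≟_ p k p^k·1≈0 = decidable-stable ((p · 1#) ≟ 0#) λ p·1≉0 →
    ^-≉0 k p·1≉0 (trans (sym (power k)) p^k·1≈0)
    where
    power : ∀ k → (p ℕ.^ k) · 1# ≈ (p · 1#) ^ k
    power zero    = ×-homo-1 1#
    power (suc k) = trans (×1-homo-* p (p ℕ.^ k)) (*-congˡ (power k))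

-- Finite subfields and the equation x^Q = x

module FiniteSubfield {c ℓ} (L : Field c ℓ) (_≟_ : Decidable (Field._≈_ L))
    {A : Subset L} (A-subfield : IsSubfield L A)
    {Q : ℕ} (card : HasCardinality (subsetSetoid L A) Q) where
  open FieldProperties L
  open IsSubfield A-subfield public
  open import Relation.Binary.Reasoning.Setoid setoid

  enum : Fin Q → Carrier
  enum i = proj₁ (Inverse.from card i)

  enum-∈ : ∀ i → enum i ∈ A
  enum-∈ i = proj₂ (Inverse.from card i)

  enum-injective : ∀ {i j} → enum i ≈ enum j → i ≡ j
  enum-injective = from-injective (subsetSetoid L A) card

  index : ∀ {x} → x ∈ A → Fin Q
  index {x} x∈A = Inverse.to card (x , x∈A)

  enum-index : ∀ {x} (x∈A : x ∈ A) → enum (index x∈A) ≈ x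
  enum-index x∈A = Inverse.strictlyInverseʳ card (_ , x∈A)

  ^-closed : ∀ {x} n → x ∈ A → x ^ n ∈ A
  ^-closed zero    x∈A = 1∈
  ^-closed (suc n) x∈A = *-closed x∈A (^-closed n x∈A)

  enum-permutation : (f g : Carrier → Carrier) →
    (∀ {x y} → x ≈ y → f x ≈ f y) → (∀ {x y} → x ≈ y → g x ≈ g y) →
    (∀ x → f (g x) ≈ x) → (∀ x → g (f x) ≈ x) →
    (∀ {x} → x ∈ A → f x ∈ A) → (∀ {x} → x ∈ A → g x ∈ A) →
    ∃[ π ] (∀ i → enum (π ⟨$⟩ʳ i) ≈ f (enum i))
  enum-permutation f g f-cong g-cong f∘g g∘f f∈ g∈ =
    permutation (λ i → index (f∈ (enum-∈ i))) (λ i → index (g∈ (enum-∈ i)))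
      (λ i → enum-injective (trans (enum-index _) (trans (f-cong (enum-index _)) (f∘g (enum i)))))
      (λ i → enum-injective (trans (enum-index _) (trans (g-cong (enum-index _)) (g∘f (enum i)))))
    , λ i → enum-index (f∈ (enum-∈ i))

  -- Translation by 1 permutes `A`, so the sum of all its elements is unchanged when `Q` copies of 1
  -- are added.
  card·1≈0 : Q · 1# ≈ 0#
  card·1≈0 =
    let π , π-spec = enum-permutation (1# +_) (- 1# +_) +-congˡ +-congˡ
          (λ x → trans (sym (+-assoc _ _ _)) (trans (+-congʳ (-‿inverseʳ 1#)) (+-identityˡ x)))
          (λ x → trans (sym (+-assoc _ _ _)) (trans (+-congʳ (-‿inverseˡ 1#)) (+-identityˡ x)))
          (+-closed 1∈) (+-closed (neg-closed 1∈))
    in  +-identityˡ-unique _ _ (sym (sum-translate +-commutativeMonoid enum π 1# π-spec))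

  -- Multiplication by a nonzero `x` permutes `A`. For `x` = 0 it matters that `Q` ≥ 1, which is
  -- read off from the index of 0.
  fermat : ∀ {x} → x ∈ A → x ^ Q ≈ x
  fermat {x} x∈A with x ≟ 0#
  ... | yes x≈0 = trans (^-congˡ Q x≈0) (trans (0^n≈0 (1≤Q (index 0∈))) (sym x≈0))
    where
    1≤Q : ∀ {n} → Fin n → 1 ℕ.≤ n
    1≤Q {suc _} _ = s≤s z≤n
  ... | no  x≉0 with x⁻¹ , x⁻¹x≈1 , xx⁻¹≈1 ← inverse x x≉0 =
    let π , π-spec = enum-permutation (x *_) (x⁻¹ *_) *-congˡ *-congˡ
          (λ y → trans (sym (*-assoc _ _ _)) (trans (*-congʳ xx⁻¹≈1) (*-identityˡ y)))
          (λ y → trans (sym (*-assoc _ _ _)) (trans (*-congʳ x⁻¹x≈1) (*-identityˡ y)))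
          (*-closed x∈A) (*-closed (inv-closed x∈A xx⁻¹≈1))
    in  multiplication-permutes⇒x^n≈x enum enum-injective π π-spec (index 0∈) (enum-index 0∈)

  -- Otherwise `x` and the `Q` elements of `A` would be `Q` + 1 distinct roots of X^Q - X. This
  -- turns membership in `A` into an equation to verify.
  fixed⇒∈ : 2 ℕ.≤ Q → ∀ {x} → x ^ Q ≈ x → x ∈ A
  fixed⇒∈ 2≤Q {x} x^Q≈x with Fin.any? (λ i → enum i ≟ x)
  ... | yes (i , eᵢ≈x) = ∈-resp-≈ eᵢ≈x (enum-∈ i)
  ... | no  x∉enum     = contradiction fixed (few-^-fixed 2≤Q e e-injective)
    where
    e : Fin (suc Q) → Carrier
    e zero    = x
    e (suc i) = enum i

    e-injective : ∀ {i j} → e i ≈ e j → i ≡ j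
    e-injective {zero}  {zero}  _  = ≡.refl
    e-injective {zero}  {suc j} eq = contradiction (j , sym eq) x∉enum
    e-injective {suc i} {zero}  eq = contradiction (i , eq) x∉enum
    e-injective {suc i} {suc j} eq = ≡.cong suc (enum-injective eq)

    fixed : ∀ i → e i ^ Q ≈ e i
    fixed zero    = x^Q≈x
    fixed (suc i) = fermat (enum-∈ i)

  -- X^m - X cannot vanish at m + 1 distinct elements of `A`. This is the source of both ω and the
  -- element supplying η and θ.
  ∃-unfixed : ∀ {m} → 2 ℕ.≤ m → m ℕ.< Q → ∃[ x ] x ∈ A × ¬ (x ^ m ≈ x)
  ∃-unfixed {m} 2≤m m<Q with Fin.any? (λ i → ¬? ((enum i ^ m) ≟ enum i))
  ... | yes (i , eᵢ^m≉eᵢ) = enum i , enum-∈ i , eᵢ^m≉eᵢ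
  ... | no  all-fixed =
    contradiction (λ i → decidable-stable (_ ≟ _) (λ unfixed → all-fixed (inject≤ i m<Q , unfixed)))
      (few-^-fixed 2≤m (λ i → enum (inject≤ i m<Q)) (Fin.inject≤-injective m<Q m<Q _ _ ∘ enum-injective))

  -- Quadratic extensions in coordinates

  -- The z with (z^Q)^Q = z form the quadratic extension A + Aθ, and z = α z + β z θ.
  module Coordinates (2≤Q : 2 ℕ.≤ Q) (additive : AdditivePower Q)
      {θ : Carrier} (θ-involutive : (θ ^ Q) ^ Q ≈ θ) (θ-unfixed : ¬ (θ ^ Q ≈ θ)) where

    -- For `A` = `F` this equation cuts out K inside `L`; for `A` = `M` it holds on all of `L`.
    Involutive : Carrier → Set ℓ
    Involutive k = (k ^ Q) ^ Q ≈ k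

    ∈⇒Involutive : ∀ {k} → k ∈ A → Involutive k
    ∈⇒Involutive k∈A = trans (^-congˡ Q (fermat k∈A)) (fermat k∈A)

    Involutive-+ : ∀ {k l} → Involutive k → Involutive l → Involutive (k + l)
    Involutive-+ {k} {l} k-inv l-inv =
      trans (^-congˡ Q (additive k l)) (trans (additive (k ^ Q) (l ^ Q)) (+-cong k-inv l-inv))

    Involutive-* : ∀ {k l} → Involutive k → Involutive l → Involutive (k * l)
    Involutive-* {k} {l} k-inv l-inv =
      trans (^-congˡ Q (^-distrib-* k l Q)) (trans (^-distrib-* (k ^ Q) (l ^ Q) Q) (*-cong k-inv l-inv))

    Involutive-inverse : ∀ {k l} → k * l ≈ 1# → Involutive k → Involutive l
    Involutive-inverse {k} {l} kl≈1 k-inv =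
      *-cancelˡ-≉0 (x*y≉0⇒x≉0 λ kl≈0 → 0≉1 (trans (sym kl≈0) kl≈1)) (begin
      k * (l ^ Q) ^ Q             ≈⟨ *-congʳ k-inv ⟨
      (k ^ Q) ^ Q * (l ^ Q) ^ Q   ≈⟨ ^-distrib-* (k ^ Q) (l ^ Q) Q ⟨
      (k ^ Q * l ^ Q) ^ Q         ≈⟨ ^-congˡ Q (^-distrib-* k l Q) ⟨
      ((k * l) ^ Q) ^ Q           ≈⟨ ^-congˡ Q (^-congˡ Q kl≈1) ⟩
      (1# ^ Q) ^ Q                ≈⟨ trans (^-congˡ Q (1^n≈1 Q)) (1^n≈1 Q) ⟩
      1#                          ≈⟨ kl≈1 ⟨
      k * l                       ∎)

    private
      1≤Q = ℕ.<⇒≤ 2≤Q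

      θ-θ^Q : Carrier
      θ-θ^Q = θ - θ ^ Q

      θ-θ^Q≉0 : ¬ (θ-θ^Q ≈ 0#)
      θ-θ^Q≉0 eq = θ-unfixed (sym (x-y≈0⇒x≈y θ (θ ^ Q) eq))

      δ : Carrier
      δ = proj₁ (inverse θ-θ^Q θ-θ^Q≉0)

    -- If z = a + bθ with a, b in `A`, then z^Q = a + bθ^Q, and subtracting gives b(θ - θ^Q) = z -
    -- z^Q; `δ` is the inverse of θ - θ^Q.
    α β : Carrier → Carrier
    β z = (z - z ^ Q) * δ
    α z = z - β z * θ

    β-cong : ∀ {z w} → z ≈ w → β z ≈ β w
    β-cong eq = *-congʳ (+-cong eq (-‿cong (^-congˡ Q eq)))

    α-cong : ∀ {z w} → z ≈ w → α z ≈ α w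
    α-cong eq = +-cong eq (-‿cong (*-congʳ (β-cong eq)))

    decomposition : ∀ z → α z + β z * θ ≈ z
    decomposition z = begin
      z - β z * θ + β z * θ      ≈⟨ +-assoc _ _ _ ⟩
      z + (- (β z * θ) + β z * θ) ≈⟨ +-congˡ (-‿inverseˡ _) ⟩
      z + 0#                     ≈⟨ +-identityʳ z ⟩
      z                          ∎

    private
      β-spec : ∀ z → β z * θ-θ^Q ≈ z - z ^ Q
      β-spec z = begin
        (z - z ^ Q) * δ * θ-θ^Q    ≈⟨ *-assoc _ _ _ ⟩
        (z - z ^ Q) * (δ * θ-θ^Q)  ≈⟨ *-congˡ (proj₁ (proj₂ (inverse θ-θ^Q θ-θ^Q≉0))) ⟩
        (z - z ^ Q) * 1#           ≈⟨ *-identityʳ _ ⟩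
        z - z ^ Q                  ∎

      β-determined : ∀ {b z} → b * θ-θ^Q ≈ z - z ^ Q → b ≈ β z
      β-determined {b} {z} eq = *-cancelˡ-≉0 θ-θ^Q≉0 (begin
        θ-θ^Q * b    ≈⟨ *-comm _ _ ⟩
        b * θ-θ^Q    ≈⟨ eq ⟩
        z - z ^ Q    ≈⟨ β-spec z ⟨
        β z * θ-θ^Q  ≈⟨ *-comm _ _ ⟩
        θ-θ^Q * β z  ∎)

      ^Q-flips : ∀ {z} → Involutive z → (z - z ^ Q) ^ Q ≈ - (z - z ^ Q)
      ^Q-flips {z} z-involutive = begin
        (z - z ^ Q) ^ Q        ≈⟨ AdditivePower-sub 1≤Q additive z (z ^ Q) ⟩
        z ^ Q - (z ^ Q) ^ Q    ≈⟨ +-congˡ (-‿cong z-involutive) ⟩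
        z ^ Q - z              ≈⟨ ⁻¹-anti-homo-// z (z ^ Q) ⟨
        - (z - z ^ Q)          ∎

    -- Both z - z^Q and θ - θ^Q change sign under the Q-th power, so their quotient is fixed by it.
    β-∈ : ∀ {z} → Involutive z → β z ∈ A
    β-∈ {z} z-involutive = fixed⇒∈ 2≤Q (β-determined (-‿injective (begin
      - (β z ^ Q * θ-θ^Q)      ≈⟨ -‿distribʳ-* _ _ ⟩
      β z ^ Q * - θ-θ^Q        ≈⟨ *-congˡ (^Q-flips θ-involutive) ⟨
      β z ^ Q * θ-θ^Q ^ Q      ≈⟨ ^-distrib-* (β z) θ-θ^Q Q ⟨
      (β z * θ-θ^Q) ^ Q        ≈⟨ ^-congˡ Q (β-spec z) ⟩
      (z - z ^ Q) ^ Q          ≈⟨ ^Q-flips z-involutive ⟩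
      - (z - z ^ Q)            ∎)))

    α-∈ : ∀ {z} → Involutive z → α z ∈ A
    α-∈ {z} z-involutive = fixed⇒∈ 2≤Q (begin
      (z - β z * θ) ^ Q          ≈⟨ AdditivePower-sub 1≤Q additive z (β z * θ) ⟩
      z ^ Q - (β z * θ) ^ Q      ≈⟨ +-congˡ (-‿cong (^-distrib-* (β z) θ Q)) ⟩
      z ^ Q - β z ^ Q * θ ^ Q    ≈⟨ +-congˡ (-‿cong (*-congʳ (fermat (β-∈ z-involutive)))) ⟩
      z ^ Q - β z * θ ^ Q        ≈⟨ sym (x+y≈z+w⇒x-z≈w-y z+βθ^Q≈βθ+z^Q) ⟩
      z - β z * θ                ∎)
      where
      z+βθ^Q≈βθ+z^Q : z + β z * θ ^ Q ≈ β z * θ + z ^ Q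
      z+βθ^Q≈βθ+z^Q = x-y≈z-w⇒x+w≈z+y (begin
        z - z ^ Q                ≈⟨ β-spec z ⟨
        β z * (θ - θ ^ Q)        ≈⟨ x[y-z]≈xy-xz (β z) θ (θ ^ Q) ⟩
        β z * θ - β z * θ ^ Q    ∎)

    conjugate : ∀ {a b} → a ∈ A → b ∈ A → (a + b * θ) ^ Q ≈ a + b * θ ^ Q
    conjugate {a} {b} a∈A b∈A = begin
      (a + b * θ) ^ Q          ≈⟨ additive a (b * θ) ⟩
      a ^ Q + (b * θ) ^ Q      ≈⟨ +-cong (fermat a∈A) (^-distrib-* b θ Q) ⟩
      a + b ^ Q * θ ^ Q        ≈⟨ +-congˡ (*-congʳ (fermat b∈A)) ⟩
      a + b * θ ^ Q            ∎

    -- Subtracting the conjugate eliminates a and determines b. The coordinates of sums, multiples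
    -- and values of φ are all read off this way.
    coordinates-unique : ∀ {a b z} → a ∈ A → b ∈ A → a + b * θ ≈ z → α z ≈ a × β z ≈ b
    coordinates-unique {a} {b} {z} a∈A b∈A eq = αz≈a , sym b≈βz
      where
      b≈βz : b ≈ β z
      b≈βz = β-determined (begin
        b * (θ - θ ^ Q)          ≈⟨ x[y-z]≈xy-xz b θ (θ ^ Q) ⟩
        b * θ - b * θ ^ Q
          ≈⟨ x+y≈z+w⇒x-z≈w-y (solve 3 (λ a x y → x :+ (a :+ y) := y :+ (a :+ x))
               refl a (b * θ) (b * θ ^ Q)) ⟩
        a + b * θ - (a + b * θ ^ Q)
          ≈⟨ +-cong eq (-‿cong (trans (sym (conjugate a∈A b∈A)) (^-congˡ Q eq))) ⟩
        z - z ^ Q                ∎)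
      αz≈a : α z ≈ a
      αz≈a = +-cancelʳ (b * θ) (α z) a (begin
        α z + b * θ    ≈⟨ +-congˡ (*-congʳ b≈βz) ⟩
        α z + β z * θ  ≈⟨ decomposition z ⟩
        z              ≈⟨ eq ⟨
        a + b * θ      ∎)

    independent : ∀ {a b} → a ∈ A → b ∈ A → a + b * θ ≈ 0# → a ≈ 0# × b ≈ 0#
    independent a∈A b∈A eq =
      let α≈a , β≈b = coordinates-unique a∈A b∈A eq
          α≈0 , β≈0 = coordinates-unique 0∈ 0∈ (trans (+-identityˡ _) (zeroˡ θ))
      in  trans (sym α≈a) α≈0 , trans (sym β≈b) β≈0

    -- The semilinear map φ

    -- For z = a + bθ, φ(z) ∈ Az would force η b^{q+1} = a^{q+1}.
    module Twist (involutive : ∀ z → Involutive z) {q : ℕ} (q-additive : AdditivePower q)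
        {η : Carrier} (η-nonpower : ∀ {x} → x ∈ A → ¬ (x ^ suc q ≈ η)) where

      φ : Carrier → Carrier
      φ z = η * β z ^ q + α z ^ q * θ

      φ-cong : ∀ {z w} → z ≈ w → φ z ≈ φ w
      φ-cong eq = +-cong (*-congˡ (^-congˡ q (β-cong eq))) (*-congʳ (^-congˡ q (α-cong eq)))

      φ-additive : ∀ z w → φ (z + w) ≈ φ z + φ w
      φ-additive z w =
        let α≈ , β≈ = coordinates-unique
              (+-closed (α-∈ (involutive z)) (α-∈ (involutive w)))
              (+-closed (β-∈ (involutive z)) (β-∈ (involutive w))) (begin
                α z + α w + (β z + β w) * θ
                  ≈⟨ solve 5 (λ a a′ b b′ t → a :+ a′ :+ (b :+ b′) :* t := (a :+ b :* t) :+ (a′ :+ b′ :* t))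
                       refl (α z) (α w) (β z) (β w) θ ⟩
                α z + β z * θ + (α w + β w * θ)    ≈⟨ +-cong (decomposition z) (decomposition w) ⟩
                z + w                              ∎)
        in begin
          η * β (z + w) ^ q + α (z + w) ^ q * θ
            ≈⟨ +-cong (*-congˡ (trans (^-congˡ q β≈) (q-additive _ _)))
                  (*-congʳ (trans (^-congˡ q α≈) (q-additive _ _))) ⟩
          η * (β z ^ q + β w ^ q) + (α z ^ q + α w ^ q) * θ
            ≈⟨ solve 6 (λ h b b′ a a′ t → h :* (b :+ b′) :+ (a :+ a′) :* t := (h :* b :+ a :* t) :+ (h :* b′ :+ a′ :* t))
                 refl η (β z ^ q) (β w ^ q) (α z ^ q) (α w ^ q) θ ⟩
          φ z + φ w                                ∎

      -- Scaling by `k` scales both coordinates, and the q-th power is multiplicative. With `A` =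
      -- `M` this covers every scalar of K.
      φ-semilinear : ∀ {k} → k ∈ A → ∀ z → φ (k * z) ≈ k ^ q * φ z
      φ-semilinear {k} k∈A z =
        let α≈ , β≈ = coordinates-unique
              (*-closed k∈A (α-∈ (involutive z)))
              (*-closed k∈A (β-∈ (involutive z))) (begin
                k * α z + k * β z * θ
                  ≈⟨ solve 4 (λ k a b t → k :* a :+ k :* b :* t := k :* (a :+ b :* t))
                       refl k (α z) (β z) θ ⟩
                k * (α z + β z * θ)       ≈⟨ *-congˡ (decomposition z) ⟩
                k * z                     ∎)
        in begin
          η * β (k * z) ^ q + α (k * z) ^ q * θ
            ≈⟨ +-cong (*-congˡ (trans (^-congˡ q β≈) (^-distrib-* _ _ q)))
                  (*-congʳ (trans (^-congˡ q α≈) (^-distrib-* _ _ q))) ⟩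
          η * (k ^ q * β z ^ q) + k ^ q * α z ^ q * θ
            ≈⟨ solve 5 (λ h b a k t → h :* (k :* b) :+ k :* a :* t := k :* (h :* b :+ a :* t))
                 refl η (β z ^ q) (α z ^ q) (k ^ q) θ ⟩
          k ^ q * φ z                              ∎

      φ-scattered : η ∈ A → ∀ {m z} → m ∈ A → ¬ (z ≈ 0#) → ¬ (φ z ≈ m * z)
      φ-scattered η∈A {m} {z} m∈A z≉0 φz≈mz = contra
        where
        a = α z
        b = β z

        a∈A : a ∈ A
        a∈A = α-∈ (involutive z)

        b∈A : b ∈ A
        b∈A = β-∈ (involutive z)

        φz-coordinates : α (φ z) ≈ η * b ^ q × β (φ z) ≈ a ^ q
        φz-coordinates = coordinates-unique (*-closed η∈A (^-closed q b∈A)) (^-closed q a∈A) refl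

        mz-coordinates : α (φ z) ≈ m * a × β (φ z) ≈ m * b
        mz-coordinates = coordinates-unique (*-closed m∈A a∈A) (*-closed m∈A b∈A) (begin
          m * a + m * b * θ
            ≈⟨ solve 4 (λ m a b t → m :* a :+ m :* b :* t := m :* (a :+ b :* t)) refl m a b θ ⟩
          m * (a + b * θ)      ≈⟨ *-congˡ (decomposition z) ⟩
          m * z                ≈⟨ φz≈mz ⟨
          φ z                  ∎)

        -- Comparing coordinates gives a^q = mb and ηb^q = ma; multiplying by a and by b
        -- respectively eliminates m.
        norms : a ^ suc q ≈ η * b ^ suc q
        norms = begin
          a * a ^ q
            ≈⟨ *-congˡ (trans (sym (proj₂ φz-coordinates)) (proj₂ mz-coordinates)) ⟩
          a * (m * b)        ≈⟨ solve 3 (λ a m b → a :* (m :* b) := b :* (m :* a)) refl a m b ⟩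
          b * (m * a)
            ≈⟨ *-congˡ (trans (sym (proj₁ mz-coordinates)) (proj₁ φz-coordinates)) ⟩
          b * (η * b ^ q)
            ≈⟨ solve 3 (λ b h c → b :* (h :* c) := h :* (b :* c)) refl b η (b ^ q) ⟩
          η * (b * b ^ q)    ∎

        contra : ⊥
        contra with b ≟ 0#
        ... | yes b≈0 = z≉0 (begin
          z               ≈⟨ decomposition z ⟨
          a + b * θ       ≈⟨ +-cong a≈0 (*-congʳ b≈0) ⟩
          0# + 0# * θ     ≈⟨ trans (+-identityˡ _) (zeroˡ θ) ⟩
          0#              ∎)
          where
          a≈0 : a ≈ 0#
          a≈0 = decidable-stable (a ≟ 0#) λ a≉0 → ^-≉0 (suc q) a≉0 (begin
            a ^ suc q             ≈⟨ norms ⟩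
            η * (b * b ^ q)       ≈⟨ *-congˡ (*-congʳ b≈0) ⟩
            η * (0# * b ^ q)      ≈⟨ *-congˡ (zeroˡ _) ⟩
            η * 0#                ≈⟨ zeroʳ η ⟩
            0#                    ∎)
        -- Dividing `norms` by b^(q+1) would exhibit η as the (q+1)-th power of a/b.
        ... | no  b≉0 with b⁻¹ , b⁻¹b≈1 , bb⁻¹≈1 ← inverse b b≉0 =
          η-nonpower (*-closed a∈A (inv-closed b∈A bb⁻¹≈1)) (begin
            (a * b⁻¹) ^ suc q                  ≈⟨ ^-distrib-* a b⁻¹ (suc q) ⟩
            a ^ suc q * b⁻¹ ^ suc q            ≈⟨ *-congʳ norms ⟩
            η * b ^ suc q * b⁻¹ ^ suc q        ≈⟨ *-assoc _ _ _ ⟩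
            η * (b ^ suc q * b⁻¹ ^ suc q)      ≈⟨ *-congˡ (^-distrib-* b b⁻¹ (suc q)) ⟨
            η * (b * b⁻¹) ^ suc q
              ≈⟨ *-congˡ (trans (^-congˡ (suc q) bb⁻¹≈1) (1^n≈1 (suc q))) ⟩
            η * 1#                             ≈⟨ *-identityʳ η ⟩
            η                                  ∎)

    -- The twisted line spread

    open PG L A

    multiples-≐ : ∀ {j u v} → j ∈ A → ¬ (v ≈ 0#) → v ≈ j * u → multiples L A u ≐ multiples L A v
    multiples-≐ {j} {u} {v} j∈A v≉0 v≈ju
      with j⁻¹ , j⁻¹j≈1 , jj⁻¹≈1 ← inverse j (x*y≉0⇒x≉0 (v≉0 ∘ trans v≈ju)) =
        (λ (a , a∈A , y≈au) → a * j⁻¹ , *-closed a∈A (inv-closed j∈A jj⁻¹≈1) ,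
           trans y≈au (trans (x⁻¹x≈1⇒yz≈yx⁻¹[xz] j⁻¹j≈1 a u) (*-congˡ (sym v≈ju))))
      , (λ (a , a∈A , y≈av) → a * j , *-closed a∈A j∈A ,
           trans y≈av (trans (*-congˡ v≈ju) (sym (*-assoc a j u))))

    -- Here `A` is the ground field and `Q` its order, whereas φ is built in coordinates over `M`;
    -- so φ enters only through its properties.
    module TwistedSpread {N : ℕ} (finite : HasCardinality setoid N)
        {M : Subset L} (M-subfield : IsSubfield L M) (Involutive⊆M : ∀ {k} → Involutive k → k ∈ M)
        (φ : Carrier → Carrier) (φ-cong : ∀ {z w} → z ≈ w → φ z ≈ φ w)
        (φ-additive : ∀ z w → φ (z + w) ≈ φ z + φ w)
        (φ-semilinear : ∀ {k} → Involutive k → ∀ z → φ (k * z) ≈ k ^ Q * φ z)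
        (φ-scattered : ∀ {m z} → m ∈ M → ¬ (z ≈ 0#) → ¬ (φ z ≈ m * z)) where

      private module M = IsSubfield M-subfield

      ψ : Carrier → Carrier
      ψ z = z + φ z

      ψ-cong : ∀ {z w} → z ≈ w → ψ z ≈ ψ w
      ψ-cong eq = +-cong eq (φ-cong eq)

      ψ-additive : ∀ z w → ψ (z + w) ≈ ψ z + ψ w
      ψ-additive z w = trans (+-congˡ (φ-additive z w))
        (solve 4 (λ z w z′ w′ → z :+ w :+ (z′ :+ w′) := z :+ z′ :+ (w :+ w′)) refl z w (φ z) (φ w))

      ψ-linear : ∀ {a} → a ∈ A → ∀ z → ψ (a * z) ≈ a * ψ z
      ψ-linear {a} a∈A z = begin
        a * z + φ (a * z)     ≈⟨ +-congˡ (φ-semilinear (∈⇒Involutive a∈A) z) ⟩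
        a * z + a ^ Q * φ z   ≈⟨ +-congˡ (*-congʳ (fermat a∈A)) ⟩
        a * z + a * φ z       ≈⟨ distribˡ a z (φ z) ⟨
        a * ψ z               ∎

      -- A nonzero kernel element would satisfy φ(z) = -z, an M-multiple of z.
      ψ-kernel : ∀ {z} → ψ z ≈ 0# → z ≈ 0#
      ψ-kernel {z} ψz≈0 = decidable-stable (z ≟ 0#) λ z≉0 →
        φ-scattered (M.neg-closed M.1∈) z≉0 (begin
          φ z       ≈⟨ +-inverseˡ-unique _ _ (trans (+-comm _ _) ψz≈0) ⟩
          - z       ≈⟨ -1*x≈-x z ⟨
          - 1# * z  ∎)

      ψ-injective : ∀ {z w} → ψ z ≈ ψ w → z ≈ w
      ψ-injective {z} {w} eq = x-y≈0⇒x≈y z w (ψ-kernel (+-identityˡ-unique _ (ψ w) (begin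
        ψ (z - w) + ψ w    ≈⟨ ψ-additive (z - w) w ⟨
        ψ (z - w + w)      ≈⟨ ψ-cong (//-rightDividesˡ w z) ⟩
        ψ z                ≈⟨ eq ⟩
        ψ w                ∎)))

      ψ-≉0 : ∀ {z w} → ¬ (w ≈ 0#) → w ≈ ψ z → ¬ (z ≈ 0#)
      ψ-≉0 {z} {w} w≉0 w≈ψz z≈0 = w≉0 (begin
        w               ≈⟨ w≈ψz ⟩
        ψ z             ≈⟨ ψ-cong (trans z≈0 (sym (zeroˡ 0#))) ⟩
        ψ (0# * 0#)     ≈⟨ ψ-linear 0∈ 0# ⟩
        0# * ψ 0#       ≈⟨ zeroˡ _ ⟩
        0#              ∎)

      twistedLine : Carrier → Subset L
      twistedLine x y = ∃[ k ] Involutive k × y ≈ ψ (k * x)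

      -- The image under ψ of the basis x, θx of Kx over `A`.
      basis : Carrier → Fin 2 → Carrier
      basis x zero       = ψ x
      basis x (suc zero) = ψ (θ * x)

      linearCombination-basis : ∀ {x} (a : Fin 2 → Carrier) → (∀ i → a i ∈ A) →
        linearCombination a (basis x) ≈ ψ ((a zero + a (suc zero) * θ) * x)
      linearCombination-basis {x} a a∈A = begin
        a₀ * ψ x + (a₁ * ψ (θ * x) + 0#)
          ≈⟨ +-cong (sym (ψ-linear (a∈A zero) x)) (trans (+-identityʳ _) (sym (ψ-linear (a∈A (suc zero)) (θ * x)))) ⟩
        ψ (a₀ * x) + ψ (a₁ * (θ * x))        ≈⟨ ψ-additive _ _ ⟨
        ψ (a₀ * x + a₁ * (θ * x))
          ≈⟨ ψ-cong (solve 4 (λ a b t x → a :* x :+ b :* (t :* x) := (a :+ b :* t) :* x)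
               refl a₀ a₁ θ x) ⟩
        ψ ((a₀ + a₁ * θ) * x)                ∎
        where
        a₀ = a zero
        a₁ = a (suc zero)

      twistedLine-isLine : ∀ {x U} → ¬ (x ≈ 0#) → U ≐ twistedLine x → IsLine U
      twistedLine-isLine {x} {U} x≉0 (U⊆ , ⊆U) = basis x , linearlyIndependent , to-span , from-span
        where
        linearlyIndependent : LinearlyIndependent (basis x)
        linearlyIndependent a a∈A eq = λ { zero → proj₁ a≈0 ; (suc zero) → proj₂ a≈0 }
          where
          a≈0 : a zero ≈ 0# × a (suc zero) ≈ 0#
          a≈0 = independent (a∈A zero) (a∈A (suc zero))
            (xy≈0∧x≉0⇒y≈0 x≉0 (trans (*-comm _ _)
              (ψ-kernel (trans (sym (linearCombination-basis a a∈A)) eq))))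

        to-span : U ⊆ Span (basis x)
        to-span {y} y∈U with k , k-inv , y≈ψkx ← U⊆ y∈U = a , a∈A , (begin
            y                              ≈⟨ y≈ψkx ⟩
            ψ (k * x)                      ≈⟨ ψ-cong (*-congʳ (decomposition k)) ⟨
            ψ ((α k + β k * θ) * x)        ≈⟨ linearCombination-basis a a∈A ⟨
            linearCombination a (basis x)  ∎)
          where
          a : Fin 2 → Carrier
          a zero       = α k
          a (suc zero) = β k
          a∈A : ∀ i → a i ∈ A
          a∈A zero       = α-∈ k-inv
          a∈A (suc zero) = β-∈ k-inv

        from-span : Span (basis x) ⊆ U
        from-span (a , a∈A , eq) = ⊆U
          ( a zero + a (suc zero) * θ
          , Involutive-+ (∈⇒Involutive (a∈A zero)) (Involutive-* (∈⇒Involutive (a∈A (suc zero))) θ-involutive)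
          , trans eq (linearCombination-basis a a∈A))

      -- Since x = k⁻¹k′x′ with k⁻¹k′ in K, already Kx lies in Kx′. For `unique`, the common vector
      -- kx = k′x′ is the preimage under ψ of a common point.
      twistedLine-⊆ : ∀ {k k′ x x′} → Involutive k → Involutive k′ → ¬ (k ≈ 0#) → k * x ≈ k′ * x′ →
                      twistedLine x ⊆ twistedLine x′
      twistedLine-⊆ {k} {k′} {x} {x′} k-inv k′-inv k≉0 kx≈k′x′ {y} (j , j-inv , y≈ψjx)
        with k⁻¹ , k⁻¹k≈1 , kk⁻¹≈1 ← inverse k k≉0 =
        j * k⁻¹ * k′ , Involutive-* (Involutive-* j-inv (Involutive-inverse kk⁻¹≈1 k-inv)) k′-inv , (begin
          y                        ≈⟨ y≈ψjx ⟩
          ψ (j * x)                ≈⟨ ψ-cong (x⁻¹x≈1⇒yz≈yx⁻¹[xz] k⁻¹k≈1 j x) ⟩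
          ψ (j * k⁻¹ * (k * x))    ≈⟨ ψ-cong (*-congˡ kx≈k′x′) ⟩
          ψ (j * k⁻¹ * (k′ * x′))  ≈⟨ ψ-cong (*-assoc _ _ _) ⟨
          ψ (j * k⁻¹ * k′ * x′)    ∎)

      self-∈ : (P : Point) → proj₁ P ∈ ⟦ P ⟧
      self-∈ (z , _) = 1# , 1∈ , sym (*-identityˡ z)

      twistedSpread : Pred (Subset L) (c ⊔ ℓ)
      twistedSpread U = Σ (NonZeroElement L) λ x → U ≐ twistedLine (proj₁ x)

      twistedSpread-isLineSpread : IsLineSpread twistedSpread
      twistedSpread-isLineSpread = record
        { lines  = λ { U ((x , x≉0) , U≐) → twistedLine-isLine x≉0 U≐ }
        ; covers = covers
        ; unique = unique
        }
        where
        covers : ∀ P → ∃[ U ] U ∈ twistedSpread × P ∈ pointsOf U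
        -- Finiteness of `L` upgrades injectivity of ψ to surjectivity, which provides the line
        -- through z.
        covers (z , z≉0) with x , ψx≈z ← finite∧injective⇒surjective setoid finite ψ ψ-injective z =
          twistedLine x , ((x , ψ-≉0 z≉0 (sym ψx≈z)) , (λ y∈ → y∈) , (λ y∈ → y∈)) ,
          λ { (a , a∈A , y≈az) → a , ∈⇒Involutive a∈A ,
              trans y≈az (trans (*-congˡ (sym ψx≈z)) (sym (ψ-linear a∈A x))) }

        unique : ∀ P U V → U ∈ twistedSpread → V ∈ twistedSpread → P ∈ pointsOf U → P ∈ pointsOf V →
          U ≐ V
        unique P@(z , z≉0) U V ((x , x≉0) , U⊆ , ⊆U) ((x′ , x′≉0) , V⊆ , ⊆V) P∈U P∈V
          with k , k-inv , z≈ψkx ← U⊆ (P∈U (self-∈ P))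
             | k′ , k′-inv , z≈ψk′x′ ← V⊆ (P∈V (self-∈ P)) =
            (λ y∈U → ⊆V (twistedLine-⊆ k-inv k′-inv (x*y≉0⇒x≉0 (ψ-≉0 z≉0 z≈ψkx)) kx≈k′x′ (U⊆ y∈U)))
          , (λ y∈V → ⊆U (twistedLine-⊆ k′-inv k-inv (x*y≉0⇒x≉0 (ψ-≉0 z≉0 z≈ψk′x′)) (sym kx≈k′x′) (V⊆ y∈V)))
          where
          kx≈k′x′ : k * x ≈ k′ * x′
          kx≈k′x′ = ψ-injective (trans (sym z≈ψkx) z≈ψk′x′)

      M-proportional⇒fixed : ∀ {k m w} → Involutive k → m ∈ M → ¬ (w ≈ 0#) →
                             ψ (k * w) ≈ m * ψ w → k ^ Q ≈ k
      M-proportional⇒fixed {k} {m} {w} k-inv m∈M w≉0 eq = begin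
        k ^ Q    ≈⟨ m≈k^Q ⟨
        m        ≈⟨ k≈m ⟨
        k        ∎
        where
        relation : (k - m) * w ≈ (m - k ^ Q) * φ w
        relation = begin
          (k - m) * w                 ≈⟨ [y-z]x≈yx-zx w k m ⟩
          k * w - m * w               ≈⟨ x+y≈z+w⇒x-z≈w-y (begin
            k * w + k ^ Q * φ w         ≈⟨ +-congˡ (φ-semilinear k-inv w) ⟨
            ψ (k * w)                   ≈⟨ eq ⟩
            m * ψ w                     ≈⟨ distribˡ m w (φ w) ⟩
            m * w + m * φ w             ∎) ⟩
          m * φ w - k ^ Q * φ w       ≈⟨ [y-z]x≈yx-zx (φ w) m (k ^ Q) ⟨
          (m - k ^ Q) * φ w           ∎

        k^Q∈M : k ^ Q ∈ M
        k^Q∈M = Involutive⊆M (^-congˡ Q k-inv)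

        m-k^Q≈0 : m - k ^ Q ≈ 0#
        -- If m ≠ k^Q, `relation` could be divided by m - k^Q, making φ(w) an M-multiple of w.
        m-k^Q≈0 = decidable-stable ((m - k ^ Q) ≟ 0#) λ d≉0 →
          let d⁻¹ , d⁻¹d≈1 , dd⁻¹≈1 = inverse (m - k ^ Q) d≉0
          in  φ-scattered
                (M.*-closed (M.inv-closed (M.+-closed m∈M (M.neg-closed k^Q∈M)) dd⁻¹≈1)
                            (M.+-closed (Involutive⊆M k-inv) (M.neg-closed m∈M)))
                w≉0 (begin
                  φ w                            ≈⟨ *-identityˡ _ ⟨
                  1# * φ w                       ≈⟨ *-congʳ d⁻¹d≈1 ⟨
                  d⁻¹ * (m - k ^ Q) * φ w        ≈⟨ *-assoc _ _ _ ⟩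
                  d⁻¹ * ((m - k ^ Q) * φ w)      ≈⟨ *-congˡ relation ⟨
                  d⁻¹ * ((k - m) * w)            ≈⟨ *-assoc _ _ _ ⟨
                  d⁻¹ * (k - m) * w              ∎)

        m≈k^Q : m ≈ k ^ Q
        m≈k^Q = x-y≈0⇒x≈y m (k ^ Q) m-k^Q≈0

        k≈m : k ≈ m
        k≈m = x-y≈0⇒x≈y k m (xy≈0∧x≉0⇒y≈0 w≉0 (begin
          w * (k - m)          ≈⟨ *-comm _ _ ⟩
          (k - m) * w          ≈⟨ relation ⟩
          (m - k ^ Q) * φ w    ≈⟨ *-congʳ m-k^Q≈0 ⟩
          0# * φ w             ≈⟨ zeroˡ _ ⟩
          0#                   ∎))

      -- Let u = ψ(kx) = mz and v = ψ(lx) = nz be the two points. With w = kx and j = l/k one has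
      -- ψ(jw) = v = (n/m)ψ(w), so j lies in `A` and v = ju spans the same point as u.
      twistedSpread-scattered : ∀ U → U ∈ twistedSpread → IsScattered (pointsOf U) (DesarguesianSpread L M)
      twistedSpread-scattered U ((x , x≉0) , U⊆ , ⊆U) X ((z , z≉0) , X⊆ , ⊆X)
        P@(u , u≉0) R@(v , v≉0) P∈U P∈X R∈U R∈X
        with k , k-inv , u≈ψkx ← U⊆ (P∈U (self-∈ P))
           | l , l-inv , v≈ψlx ← U⊆ (R∈U (self-∈ R))
           | m , m∈M , u≈mz ← X⊆ (P∈X (self-∈ P))
           | n , n∈M , v≈nz ← X⊆ (R∈X (self-∈ R)) = u~v
        where
        k≉0 : ¬ (k ≈ 0#)
        k≉0 = x*y≉0⇒x≉0 (ψ-≉0 u≉0 u≈ψkx)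

        m≉0 : ¬ (m ≈ 0#)
        m≉0 = x*y≉0⇒x≉0 (u≉0 ∘ trans u≈mz)

        u~v : P ≈ₚ R
        u~v with k⁻¹ , k⁻¹k≈1 , kk⁻¹≈1 ← inverse k k≉0
               | m⁻¹ , m⁻¹m≈1 , mm⁻¹≈1 ← inverse m m≉0 = multiples-≐ j∈A v≉0 (begin
            v                ≈⟨ v≈ψj[kx] ⟩
            ψ (j * (k * x))  ≈⟨ ψ-linear j∈A (k * x) ⟩
            j * ψ (k * x)    ≈⟨ *-congˡ u≈ψkx ⟨
            j * u            ∎)
          where
          j = l * k⁻¹

          v≈ψj[kx] : v ≈ ψ (j * (k * x))
          v≈ψj[kx] = trans v≈ψlx (ψ-cong (x⁻¹x≈1⇒yz≈yx⁻¹[xz] k⁻¹k≈1 l x))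

          j∈A : j ∈ A
          j∈A = fixed⇒∈ 2≤Q (M-proportional⇒fixed
            (Involutive-* l-inv (Involutive-inverse kk⁻¹≈1 k-inv))
            (M.*-closed n∈M (M.inv-closed m∈M mm⁻¹≈1))
            (ψ-≉0 u≉0 u≈ψkx) (begin
              ψ (j * (k * x))          ≈⟨ v≈ψj[kx] ⟨
              v                        ≈⟨ v≈nz ⟩
              n * z                    ≈⟨ x⁻¹x≈1⇒yz≈yx⁻¹[xz] m⁻¹m≈1 n z ⟩
              n * m⁻¹ * (m * z)        ≈⟨ *-congˡ u≈mz ⟨
              n * m⁻¹ * u              ≈⟨ *-congˡ u≈ψkx ⟩
              n * m⁻¹ * ψ (k * x)      ∎))

-- Application to the tower F, M, L

module _ {c ℓ} (L : Field c ℓ) where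
  open Field L hiding (zero)

  -- `L` as a subfield of itself, so that `fermat` and `∃-unfixed` apply to it.
  whole : Subset L
  whole _ = Lift _ ⊤

  whole-isSubfield : IsSubfield L whole
  whole-isSubfield = record
    { ∈-resp-≈ = λ _ _ → lift tt
    ; 0∈ = lift tt
    ; 1∈ = lift tt
    ; +-closed = λ _ _ → lift tt
    ; neg-closed = λ _ → lift tt
    ; *-closed = λ _ _ → lift tt
    ; inv-closed = λ _ _ → lift tt
    }

  whole-card : ∀ {N} → HasCardinality setoid N → HasCardinality (subsetSetoid L whole) N
  whole-card card = record
    { to = λ (x , _) → to x
    ; from = λ i → from i , lift tt
    ; to-cong = to-cong
    ; from-cong = from-cong
    ; inverse = inverseˡ , inverseʳ
    }
    where open Inverse card using (to; from; to-cong; from-cong; inverseˡ; inverseʳ)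

primePower≥2 : ∀ {q} → IsPrimePower q → 2 ℕ.≤ q
primePower≥2 (p , suc k , pr , _ , ≡.refl) =
  ℕ.≤-trans (ℕ.nonTrivial⇒n>1 p {{prime⇒nonTrivial pr}}) 
    (ℕ.m≤m*n p (p ℕ.^ k) {{ℕ.m^n≢0 p k {{prime⇒nonZero pr}}}})

-- (q² − 1) ∣ (qⁿ − 1) for n even and positive, with q = 1 + r.
even-power : ∀ r m → ∃[ w ] suc r ℕ.^ (suc m ℕ.* 2) ≡ suc (suc w ℕ.* r ℕ.* (2 ℕ.+ r))
even-power r zero = 0 , (begin
  suc r ℕ.* (suc r ℕ.* 1)         ≡⟨ identity r ⟩
  suc (1 ℕ.* r ℕ.* (2 ℕ.+ r))     ∎)
  where
  open ≡.≡-Reasoning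
  identity : ∀ r → suc r ℕ.* (suc r ℕ.* 1) ≡ suc (1 ℕ.* r ℕ.* (2 ℕ.+ r))
  identity = solve-∀
-- From q^(n+2) - 1 = q²(q^n - 1) + (q² - 1), the cofactor w + 1 becomes q²(w + 1) + 1.
even-power r (suc m) with w , eq ← even-power r m = suc r ℕ.* (suc r ℕ.* suc w) , (begin
  suc r ℕ.* (suc r ℕ.* suc r ℕ.^ (suc m ℕ.* 2))
    ≡⟨ ≡.cong (λ x → suc r ℕ.* (suc r ℕ.* x)) eq ⟩
  suc r ℕ.* (suc r ℕ.* suc (suc w ℕ.* r ℕ.* (2 ℕ.+ r)))
    ≡⟨ identity r w ⟩
  suc (suc (suc r ℕ.* (suc r ℕ.* suc w)) ℕ.* r ℕ.* (2 ℕ.+ r)) ∎)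
  where
  open ≡.≡-Reasoning
  identity : ∀ r w → suc r ℕ.* (suc r ℕ.* suc (suc w ℕ.* r ℕ.* (2 ℕ.+ r))) ≡
                     suc (suc (suc r ℕ.* (suc r ℕ.* suc w)) ℕ.* r ℕ.* (2 ℕ.+ r))
  identity = solve-∀

mainTheorem10 : ∀ {c ℓ : Level} (q n : ℕ) → IsPrimePower q → 1 ℕ.< n →
    (L : Field c ℓ) (F M : Subset L) →
    IsSubfield L F → IsSubfield L M → F ⊆ M →
    HasCardinality (subsetSetoid L F) q →
    HasCardinality (subsetSetoid L M) (q ℕ.^ n) →
    HasCardinality (Field.setoid L) (q ℕ.^ (2 ℕ.* n)) →
    2 ∣ n →
    Σ (Pred (Subset L) (c ⊔ ℓ)) λ 𝓕 →
    PG.IsLineSpread L F 𝓕 ×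
    (∀ U → U ∈ 𝓕 → PG.IsScattered L F (PG.pointsOf L F U) (DesarguesianSpread L M))
mainTheorem10 q n q-primePower 1<n L F M F-sub M-sub F⊆M F-card M-card L-card (divides (suc m) ≡.refl)
  with s≤s (s≤s {n = r} _) ← primePower≥2 q-primePower
  with p , k , p-prime , _ , q≡p^k ← q-primePower
  -- Now q = r + 2, so the argument r + 1 is q - 1 and q^n - 1 = (w + 1)(q - 1)(q + 1).
  with w , q^n≡ ← even-power (suc r) m =
  twistedSpread , twistedSpread-isLineSpread , twistedSpread-scattered
  where
  open FieldProperties L
  open import Relation.Binary.Reasoning.Setoid setoid

  _≟_ : Decidable _≈_
  _≟_ = finite⇒≈-dec setoid L-card

  module 𝔽 = FiniteSubfield L _≟_ F-sub F-card
  module 𝕄 = FiniteSubfield L _≟_ M-sub M-card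
  module 𝕃 = FiniteSubfield L _≟_ (whole-isSubfield L) (whole-card L L-card)

  Q N : ℕ
  Q = q ℕ.^ n
  N = suc w ℕ.* suc r

  2≤q : 2 ℕ.≤ q
  2≤q = s≤s (s≤s z≤n)

  N<N[q+1] : N ℕ.< N ℕ.* suc q
  N<N[q+1] = ℕ.m<m*n N (suc q) (s≤s (s≤s z≤n))

  N+1<Q : suc N ℕ.< Q
  N+1<Q = ≡.subst (suc N ℕ.<_) (≡.sym q^n≡) (s≤s N<N[q+1])

  2≤Q : 2 ℕ.≤ Q
  2≤Q = ℕ.≤-trans (s≤s (s≤s z≤n)) (ℕ.<⇒≤ N+1<Q)

  q-additive : AdditivePower q
  q-additive = ≡.subst AdditivePower (≡.sym q≡p^k) (AdditivePower-^ {p} (frobenius p-prime p·1≈0) k)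
    where
    p·1≈0 : p · 1# ≈ 0#
    p·1≈0 = [p^k]·1≈0⇒p·1≈0 _≟_ p k (≡.subst (λ N → N · 1# ≈ 0#) q≡p^k 𝔽.card·1≈0)

  Q*Q≡ : Q ℕ.* Q ≡ q ℕ.^ (2 ℕ.* n)
  Q*Q≡ = ≡.trans (≡.sym (ℕ.^-distribˡ-+-* q n n))
    (≡.cong (λ k → q ℕ.^ (n ℕ.+ k)) (≡.sym (ℕ.+-identityʳ n)))

  -- |L| = Q², so this is Fermat's identity in `L`; it presents `L` as the quadratic extension of
  -- `M`.
  ^Q-involutive : ∀ z → (z ^ Q) ^ Q ≈ z
  ^Q-involutive z = trans (^-assocʳ z Q Q) (trans (^-congʳ z Q*Q≡) (𝕃.fermat (lift tt)))

  Q<|L| : Q ℕ.< q ℕ.^ (2 ℕ.* n)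
  Q<|L| = ≡.subst (Q ℕ.<_) Q*Q≡ (ℕ.m<m*n Q Q {{ℕ.>-nonZero (ℕ.<⇒≤ 2≤Q)}} 2≤Q)

  -- Elements of `M` are fixed by the Q-th power, so ω lies outside `M` and 1, ω is a basis of `L`
  -- over `M`.
  ω-exists : ∃[ ω ] ω ∈ whole L × ¬ (ω ^ Q ≈ ω)
  ω-exists = 𝕃.∃-unfixed 2≤Q Q<|L|

  module Over𝕄 = 𝕄.Coordinates 2≤Q (AdditivePower-^ {q} q-additive n)
    (^Q-involutive (proj₁ ω-exists)) (proj₂ (proj₂ ω-exists))

  -- Since |M| − 1 = N (q + 1), an x that is not an N-th root of unity is not a
  -- (q+1)-th power, and x^N = θ^{q−1} ≠ 1 for θ = x^{w+1}.
  x-exists : ∃[ x ] x ∈ M × ¬ (x ^ suc N ≈ x)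
  x-exists = 𝕄.∃-unfixed (s≤s (s≤s z≤n)) N+1<Q

  x : Carrier
  x = proj₁ x-exists

  x∈M : x ∈ M
  x∈M = proj₁ (proj₂ x-exists)

  x^[N+1]≉x : ¬ (x ^ suc N ≈ x)
  x^[N+1]≉x = proj₂ (proj₂ x-exists)

  x≉0 : ¬ (x ≈ 0#)
  x≉0 x≈0 = x^[N+1]≉x (trans (*-congʳ x≈0) (trans (zeroˡ _) (sym x≈0)))

  -- Raising to the power N + 1 rather than N leaves the exponent Q + q, to which y^Q = y applies
  -- without dividing by y.
  x-nonpower : ∀ {y} → y ∈ M → ¬ (y ^ suc q ≈ x)
  x-nonpower {y} y∈M y^[q+1]≈x = x^[N+1]≉x (begin
    x ^ suc N             ≈⟨ ^-congˡ (suc N) y^[q+1]≈x ⟨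
    (y ^ suc q) ^ suc N   ≈⟨ ^-assocʳ y (suc q) (suc N) ⟩
    y ^ (suc q ℕ.* suc N) ≈⟨ ^-congʳ y exponent ⟩
    y ^ (Q ℕ.+ q)         ≈⟨ ^-homo-* y Q q ⟩
    y ^ Q * y ^ q         ≈⟨ *-congʳ (𝕄.fermat y∈M) ⟩
    y ^ suc q             ≈⟨ y^[q+1]≈x ⟩
    x                     ∎)
    where
    identity : ∀ q N → suc q ℕ.* suc N ≡ suc (N ℕ.* suc q) ℕ.+ q
    identity = solve-∀
    exponent : suc q ℕ.* suc N ≡ Q ℕ.+ q
    exponent = ≡.trans (identity q N) (≡.cong (ℕ._+ q) (≡.sym q^n≡))

  θ : Carrier
  θ = x ^ suc w

  θ-involutive : (θ ^ q) ^ q ≈ θ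
  θ-involutive = begin
    (θ ^ q) ^ q                ≈⟨ ^-assocʳ θ q q ⟩
    θ ^ (q ℕ.* q)              ≈⟨ ^-assocʳ x (suc w) (q ℕ.* q) ⟩
    x ^ (suc w ℕ.* (q ℕ.* q))  ≈⟨ ^-congʳ x exponent ⟩
    x ^ (Q ℕ.+ w)              ≈⟨ ^-homo-* x Q w ⟩
    x ^ Q * x ^ w              ≈⟨ *-congʳ (𝕄.fermat x∈M) ⟩
    x ^ suc w                  ∎
    where
    identity : ∀ r w → suc w ℕ.* (suc r ℕ.* suc r) ≡ suc (suc w ℕ.* r ℕ.* (2 ℕ.+ r)) ℕ.+ w
    identity = solve-∀
    -- Because (w + 1)(q² - 1) = Q - 1.
    exponent : suc w ℕ.* (q ℕ.* q) ≡ Q ℕ.+ w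
    exponent = ≡.trans (identity (suc r) w) (≡.cong (ℕ._+ w) (≡.sym q^n≡))

  θ-unfixed : ¬ (θ ^ q ≈ θ)
  θ-unfixed θ^q≈θ = x^[N+1]≉x (begin
    x * x ^ N    ≈⟨ *-congˡ x^N≈1 ⟩
    x * 1#       ≈⟨ *-identityʳ x ⟩
    x            ∎)
    where
    x^N≈1 : x ^ N ≈ 1#
    x^N≈1 = *-cancelˡ-≉0 (^-≉0 (suc w) x≉0) (begin
      x ^ suc w * x ^ N        ≈⟨ ^-homo-* x (suc w) N ⟨
      -- N = (w + 1)(q - 1), so (w + 1) + N = (w + 1)q and θ · x^N = θ^q.
      x ^ (suc w ℕ.+ N)        ≈⟨ ^-congʳ x (ℕ.*-suc (suc w) (suc r)) ⟨
      x ^ (suc w ℕ.* q)        ≈⟨ ^-assocʳ x (suc w) q ⟨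
      θ ^ q                    ≈⟨ θ^q≈θ ⟩
      θ                        ≈⟨ *-identityʳ θ ⟨
      θ * 1#                   ∎)

  module Over𝔽 = 𝔽.Coordinates 2≤q q-additive θ-involutive θ-unfixed

  -- K = F + Fθ, and θ is a power of `x` in `M`. Evenness of `n` enters through the exponent w + 1 =
  -- (q^n - 1)/(q² - 1).
  Involutive⊆M : ∀ {k} → Over𝔽.Involutive k → k ∈ M
  Involutive⊆M {k} k-inv = 𝕄.∈-resp-≈ (Over𝔽.decomposition k)
    (𝕄.+-closed (F⊆M (Over𝔽.α-∈ k-inv)) (𝕄.*-closed (F⊆M (Over𝔽.β-∈ k-inv)) (𝕄.^-closed (suc w) x∈M)))

  -- Here η is `x`.
  open Over𝕄.Twist ^Q-involutive {q} q-additive x-nonpower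

  open Over𝔽.TwistedSpread L-card M-sub Involutive⊆M
    φ φ-cong φ-additive (λ k-inv → φ-semilinear (Involutive⊆M k-inv)) (φ-scattered x∈M)
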